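{- Let $k$ and $n$ be non-negative integers and let $m,\alpha,\beta\ge 1$ be integers with $2\nmid\alpha$. Let $p\ge 3$ be a prime such that $p\equiv 3\pmod 4$. Let $r$ be a non-negative integer such that $p$ divides $4r+3$. Then $$\bar a_{2^m\alpha}\left(4p^{k+1}n+4pr+3p\right)\equiv p^2\,\bar a_{2^m\alpha}\left(4p^{k-1}n+\frac{4r+3}{p}\right)\pmod{2^{m+2}},$$ $$\bar a_{2\beta+1}\left(4p^{k+1}n+4pr+3p\right)\equiv p^2\,\bar a_{2\beta+1}\left(4p^{k-1}n+\frac{4r+3}{p}\right)\pmod 4.$$
   Context: For integers $\ell\ge1$ write $f_\ell=\prod_{j\ge 1}(1-q^{\ell j})$. For a positive integer $s$, $\bar a_s(n)$ denotes the number of partitions of $n$ in which each odd part occurs in one of $s$ colors and the first occurrence of each part (parts of the same size but different colors being distinct) may be overlined. Equivalently, $$\sum_{n\ge0}\bar a_s(n)q^n=\frac{f_2^{3s-2}}{f_1^{2s}f_4^{s-1}}.$$ Convention: $\bar a_s(x)=0$ if $x$ is not a non-negative integer (this is relevant only when $k=0$ and $p\nmid n$). -}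

module Defs where

open import Data.Bool.Base using (Bool; true; false; if_then_else_)
open import Data.Fin.Base using (Fin)
open import Data.Integer.Base as ℤ using (+_)
import Data.Integer.Divisibility as ℤ
open import Data.List.Base
  using (List; []; _∷_; length; map; concatMap; cartesianProductWith; filter; allFin; upTo)
open import Data.Nat.Base using (ℕ; zero; suc; _*_)
open import Data.Nat.Divisibility using (_∣?_)
open import Data.Nat.ListAction using (sum)
open import Data.Nat.Properties using (_≟_)
open import Data.Product.Base using (Σ; _×_; _,_)
open import Data.Rational.Base using (ℚ; mkℚ)
open import Relation.Nullary.Decidable.Core using (does)

infix 4 _≡_[mod_]

_≡_[mod_] : ℕ → ℕ → ℕ → Set
x ≡ y [mod M ] = + M ℤ.∣ (+ x ℤ.- + y)

colours : ℕ → ℕ → ℕ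
colours s j = if does (2 ∣? j) then 1 else s

ColouredPart : ℕ → Set
ColouredPart s = Σ ℕ λ j → Fin (colours s j)

-- present o k: the part occurs suc k times, and its first occurrence is
-- overlined exactly when o is true.
data Occurrence : Set where
  absent  : Occurrence
  present : (overlined : Bool) (k : ℕ) → Occurrence

multiplicity : Occurrence → ℕ
multiplicity absent        = 0
multiplicity (present _ k) = suc k

-- An overpartition is recorded as a table giving, for every available
-- coloured part, how it occurs.
Table : ℕ → Set
Table s = List (ColouredPart s × Occurrence)

weight : ∀ {s} → Table s → ℕ
weight t = sum (map (λ ((j , _) , o) → j * multiplicity o) t)

colouredParts : (s n : ℕ) → List (ColouredPart s)
colouredParts s n =
  concatMap (λ j → map (j ,_) (allFin (colours s j))) (map suc (upTo n))

-- All occurrences of multiplicity at most n.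
occurrences : ℕ → List Occurrence
occurrences n =
  absent ∷ concatMap (λ k → present false k ∷ present true k ∷ []) (upTo n)

tables : ∀ {s} → ℕ → List (ColouredPart s) → List (Table s)
tables n []       = [] ∷ []
tables n (c ∷ cs) = cartesianProductWith _∷_ (map (c ,_) (occurrences n)) (tables n cs)

-- Bounding part sizes and multiplicities by n loses nothing, since parts are
-- positive and the weight is n; each overpartition of n is listed once.
overpartitions : (s n : ℕ) → List (Table s)
overpartitions s n = filter (λ t → weight t ≟ n) (tables n (colouredParts s n))

ā : ℕ → ℕ → ℕ
ā s n = length (overpartitions s n)

-- Extension of ā s by zero to rational arguments. A ℚ is in lowest terms and
-- mkℚ stores the denominator minus one, so the first clause matches exactly
-- the non-negative integers.
āℚ : ℕ → ℚ → ℕ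
āℚ s (mkℚ (+ n) zero _) = ā s n
āℚ s _                  = 0

{-# OPTIONS --safe #-}
module Submission where

-- Each coloured part j contributes 1 + 2 T_j with T_j = ∑_{k ≥ 1} q^{jk}, so all
-- products are ≡ 1 mod 2. For series ≡ 1 mod 2 whose odd-degree parts are 2M U and
-- 2M V mod 4M, the product has odd-degree part 2M (U + V) mod 4M, and the square of
-- the first one has odd-degree part 4M U mod 8M. For even j, T_j lives in even degrees.
-- Hence, for s = 2^m a and N odd, ā_s(N) ≡ 2^{m+1} a d(N) mod 2^{m+2} with d(N) the
-- number of divisors, which is odd exactly when N is a square. So N = p² M and M have
-- the same residue for odd p M, while N exactly divisible by p is not a square.
-- Odd s is the case m = 0.

open import Defs
open import Data.Bool.Base using (true; false; if_then_else_)
open import Data.Fin.Base using (Fin)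
open import Data.Integer.Base using (+_)
import Data.Integer.Base as ℤ
import Data.Integer.Properties as ℤ
import Data.Integer.Divisibility.Signed as ℤ
import Data.Integer.Tactic.RingSolver as ℤ
open import Data.List.Base
  using (List; []; _∷_; _++_; [_]; length; map; concat; concatMap; cartesianProductWith;
         filter; replicate; upTo; applyUpTo; allFin)
open import Data.List.Properties
  using (map-++; map-∘; map-cong; map-upTo; length-tabulate; map-concatMap)
import Data.Nat.Base as ℕ
open import Data.Nat.Base
  using (ℕ; zero; suc; z≤n; s≤s; _+_; _*_; _^_; _≤_; _<_; _%_; pred; NonZero)
open import Data.Nat.Coprimality using (1-coprimeTo) renaming (sym to coprime-sym)
open import Data.Nat.Divisibility
open import Data.Nat.DivMod using (m≡m%n+[m/n]*n)
open import Data.Nat.ListAction using (sum)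
open import Data.Nat.ListAction.Properties using (sum-++)
open import Data.Nat.Primality using (Prime; euclidsLemma; prime⇒nonZero)
open import Data.Nat.Properties
open import Data.Nat.Tactic.RingSolver using (solve-∀)
open import Data.Product.Base using (_×_; _,_; ∃; proj₁; proj₂)
open import Data.Rational.Base using (ℚ; mkℚ; _/_; toℚᵘ) renaming (_+_ to _+ℚ_)
import Data.Rational.Properties as ℚ
open import Data.Rational.Unnormalised.Base using (mkℚᵘ; *≡*; _≃_)
import Data.Rational.Unnormalised.Properties as ℚᵘ
open import Data.Sum.Base using (_⊎_; inj₁; inj₂; [_,_]′)
open import Function.Base using (_∘_; id)
open import Relation.Binary.Definitions using (tri<; tri≈; tri>)
open import Relation.Binary.PropositionalEquality
  using (_≡_; _≢_; refl; sym; trans; cong; cong₂; subst; subst₂;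
         module ≡-Reasoning)
open import Relation.Nullary using (yes; no; does; contradiction)
open import Relation.Nullary.Decidable using (dec-true; dec-false)
open import Relation.Unary using (Decidable)

open ≡-Reasoning

-- Finite sums over lists.

replicate-+ : ∀ {A : Set} a b {x : A} → replicate (a + b) x ≡ replicate a x ++ replicate b x
replicate-+ zero    b = refl
replicate-+ (suc a) b = cong (_ ∷_) (replicate-+ a b)

∑ : {A : Set} → List A → (A → ℕ) → ℕ
∑ xs f = sum (map f xs)

module _ {A : Set} where

  ∑-cong : ∀ {f g : A → ℕ} xs → (∀ x → f x ≡ g x) → ∑ xs f ≡ ∑ xs g
  ∑-cong xs f≗g = cong sum (map-cong f≗g xs)

  ∑-zero : ∀ {f : A → ℕ} xs → (∀ x → f x ≡ 0) → ∑ xs f ≡ 0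
  ∑-zero []       f≗0 = refl
  ∑-zero (x ∷ xs) f≗0 = cong₂ _+_ (f≗0 x) (∑-zero xs f≗0)

  ∑-++ : ∀ (f : A → ℕ) xs ys → ∑ (xs ++ ys) f ≡ ∑ xs f + ∑ ys f
  ∑-++ f xs ys = trans (cong sum (map-++ f xs ys)) (sum-++ (map f xs) (map f ys))

  ∑-+ : ∀ (f g : A → ℕ) xs → ∑ xs (λ x → f x + g x) ≡ ∑ xs f + ∑ xs g
  ∑-+ f g []       = refl
  ∑-+ f g (x ∷ xs) = trans (cong (_+_ (f x + g x)) (∑-+ f g xs))
                           (interchange (f x) (g x) (∑ xs f) (∑ xs g))
    where
    interchange : ∀ a b c d → a + b + (c + d) ≡ a + c + (b + d)
    interchange = solve-∀

  ∑-* : ∀ a (f : A → ℕ) xs → ∑ xs (λ x → a * f x) ≡ a * ∑ xs f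
  ∑-* a f []       = sym (*-zeroʳ a)
  ∑-* a f (x ∷ xs) = trans (cong (_+_ (a * f x)) (∑-* a f xs)) (sym (*-distribˡ-+ a (f x) (∑ xs f)))

  ∑-filter : ∀ {P : A → Set} (P? : Decidable P) xs →
             length (filter P? xs) ≡ ∑ xs (λ x → if does (P? x) then 1 else 0)
  ∑-filter P? []       = refl
  ∑-filter P? (x ∷ xs) with does (P? x)
  ... | true  = cong suc (∑-filter P? xs)
  ... | false = ∑-filter P? xs

  ∑-concat-replicate : ∀ (f : A → ℕ) a xs → ∑ (concat (replicate a xs)) f ≡ a * ∑ xs f
  ∑-concat-replicate f zero    xs = refl
  ∑-concat-replicate f (suc a) xs =
    trans (∑-++ f xs _) (cong (_+_ _) (∑-concat-replicate f a xs))

  -- Off-diagonal terms come in equal pairs `f x y`, `f y x`, so modulo 2 only the diagonal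
  -- survives. With `f x y = δ N (x * y)` this pairs each divisor of N with its codivisor.
  ∑-symmetric : ∀ (f : A → A → ℕ) → (∀ x y → f x y ≡ f y x) → ∀ xs →
                ∃ λ c → ∑ xs (λ x → ∑ xs (f x)) ≡ ∑ xs (λ x → f x x) + 2 * c
  ∑-symmetric f f-sym []       = 0 , refl
  ∑-symmetric f f-sym (x ∷ xs) with ∑-symmetric f f-sym xs
  ... | c , eq = ∑ xs (f x) + c , (begin
    f x x + ∑ xs (f x) + ∑ xs (λ y → f y x + ∑ xs (f y))
      ≡⟨ cong (_+_ (f x x + ∑ xs (f x))) (∑-+ (λ y → f y x) _ xs) ⟩
    f x x + ∑ xs (f x) + (∑ xs (λ y → f y x) + ∑ xs (λ y → ∑ xs (f y)))
      ≡⟨ cong₂ (λ a b → f x x + ∑ xs (f x) + (a + b)) (∑-cong xs (λ y → f-sym y x)) eq ⟩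
    f x x + ∑ xs (f x) + (∑ xs (f x) + (∑ xs (λ y → f y y) + 2 * c))
      ≡⟨ regroup (f x x) (∑ xs (f x)) _ c ⟩
    f x x + ∑ xs (λ y → f y y) + 2 * (∑ xs (f x) + c) ∎)
    where
    regroup : ∀ a b d c → a + b + (b + (d + 2 * c)) ≡ a + d + 2 * (b + c)
    regroup = solve-∀

module _ {A B : Set} where

  ∑-map : ∀ (f : B → ℕ) (g : A → B) xs → ∑ (map g xs) f ≡ ∑ xs (f ∘ g)
  ∑-map f g xs = cong sum (sym (map-∘ xs))

  ∑-concatMap : ∀ (f : B → ℕ) (g : A → List B) xs →
                ∑ (concatMap g xs) f ≡ ∑ xs (λ x → ∑ (g x) f)
  ∑-concatMap f g []       = refl
  ∑-concatMap f g (x ∷ xs) =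
    trans (∑-++ f (g x) (concatMap g xs)) (cong (_+_ _) (∑-concatMap f g xs))

  ∑-swap : ∀ (f : A → B → ℕ) xs ys →
           ∑ xs (λ x → ∑ ys (f x)) ≡ ∑ ys (λ y → ∑ xs (λ x → f x y))
  ∑-swap f []       ys = sym (∑-zero ys (λ _ → refl))
  ∑-swap f (x ∷ xs) ys =
    trans (cong (_+_ (∑ ys (f x))) (∑-swap f xs ys)) (sym (∑-+ (f x) _ ys))

∑-cartesianProductWith : ∀ {A B C : Set} (f : C → ℕ) (_·_ : A → B → C) xs ys →
  ∑ (cartesianProductWith _·_ xs ys) f ≡ ∑ xs (λ x → ∑ ys (λ y → f (x · y)))
∑-cartesianProductWith f _·_ []       ys = refl
∑-cartesianProductWith f _·_ (x ∷ xs) ys = begin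
  ∑ (map (x ·_) ys ++ cartesianProductWith _·_ xs ys) f
    ≡⟨ ∑-++ f (map (x ·_) ys) _ ⟩
  ∑ (map (x ·_) ys) f + ∑ (cartesianProductWith _·_ xs ys) f
    ≡⟨ cong₂ _+_ (∑-map f (x ·_) ys) (∑-cartesianProductWith f _·_ xs ys) ⟩
  ∑ ys (λ y → f (x · y)) + ∑ xs (λ x → ∑ ys (λ y → f (x · y))) ∎

∑-upTo-single : ∀ (f : ℕ → ℕ) {i n} → i < n → (∀ j → j ≢ i → f j ≡ 0) → ∑ (upTo n) f ≡ f i
∑-upTo-single f {i} {n} i<n f≗0 = trans (cong sum (map-upTo f n)) (go f i<n f≗0)
  where
  allZero : ∀ (f : ℕ → ℕ) n → (∀ j → f j ≡ 0) → sum (applyUpTo f n) ≡ 0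
  allZero f n f≗0 = trans (cong sum (sym (map-upTo f n))) (∑-zero (upTo n) f≗0)

  go : ∀ (f : ℕ → ℕ) {i n} → i < n → (∀ j → j ≢ i → f j ≡ 0) → sum (applyUpTo f n) ≡ f i
  go f {zero}  {suc n} _         f≗0 =
    trans (cong (_+_ (f 0)) (allZero (f ∘ suc) n (λ j → f≗0 (suc j) λ ()))) (+-identityʳ (f 0))
  go f {suc i} {suc n} (s≤s i<n) f≗0 =
    cong₂ _+_ (f≗0 0 λ ()) (go (f ∘ suc) i<n (λ j j≢i → f≗0 (suc j) (j≢i ∘ suc-injective)))

-- Parity and functions supported on odd degrees.

parity : ℕ → ℕ
parity 0             = 0
parity 1             = 1
parity (suc (suc n)) = parity n

parity-split : ∀ m n → parity (m + n) ≡ 0 ⊎ parity m + parity n ≡ 1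
parity-split 0             0             = inj₁ refl
parity-split 0             1             = inj₂ refl
parity-split 0             (suc (suc n)) = parity-split 0 n
parity-split 1             0             = inj₂ refl
parity-split 1             1             = inj₁ refl
parity-split 1             (suc (suc n)) = parity-split 1 n
parity-split (suc (suc m)) n             = parity-split m n

parity-bit : ∀ n → parity n ≡ 0 ⊎ parity n ≡ 1
parity-bit 0             = inj₁ refl
parity-bit 1             = inj₂ refl
parity-bit (suc (suc n)) = parity-bit n

parity≡0⇒even : ∀ n → parity n ≡ 0 → 2 ∣ n
parity≡0⇒even 0             _  = 2 ∣0
parity≡0⇒even (suc (suc n)) eq = ∣m∣n⇒∣m+n ∣-refl (parity≡0⇒even n eq)

even⇒parity≡0 : ∀ {n} → 2 ∣ n → parity n ≡ 0
even⇒parity≡0 (divides q refl) = go q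
  where
  go : ∀ q → parity (q * 2) ≡ 0
  go zero    = refl
  go (suc q) = go q

-- Such an `f` is a test function: pairing a series with it sees only the odd-degree coefficients.
OddSupported : (ℕ → ℕ) → Set
OddSupported f = ∀ w → 2 ∣ w → f w ≡ 0

parity-*-odd : ∀ {f} → OddSupported f → ∀ w → parity w * f w ≡ f w
parity-*-odd {f} f-odd w with parity-bit w
... | inj₁ eq = trans (cong (_* f w) eq) (sym (f-odd w (parity≡0⇒even w eq)))
... | inj₂ eq = trans (cong (_* f w) eq) (+-identityʳ (f w))

-- Where `f (m + n)` can be nonzero, exactly one of `m` and `n` is odd, so the two parities act as
-- complementary 0/1 selectors.
odd-split : ∀ {f} → OddSupported f → ∀ m n →
            f (m + n) ≡ parity m * f (m + n) + parity n * f (m + n)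
odd-split {f} f-odd m n with parity-split m n
... | inj₁ eq = begin
  f (m + n)                                      ≡⟨ f≡0 ⟩
  0                                              ≡⟨ cong₂ _+_ (*-zeroʳ (parity m)) (*-zeroʳ (parity n)) ⟨
  parity m * 0 + parity n * 0                    ≡⟨ cong (λ x → parity m * x + parity n * x) f≡0 ⟨
  parity m * f (m + n) + parity n * f (m + n)    ∎
  where f≡0 = f-odd (m + n) (parity≡0⇒even (m + n) eq)
... | inj₂ eq = begin
  f (m + n)                                      ≡⟨ +-identityʳ (f (m + n)) ⟨
  1 * f (m + n)                                  ≡⟨ cong (_* f (m + n)) eq ⟨
  (parity m + parity n) * f (m + n)              ≡⟨ *-distribʳ-+ (f (m + n)) (parity m) (parity n) ⟩
  parity m * f (m + n) + parity n * f (m + n)    ∎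

-- Truncated generating functions, represented by lists of exponents.

module Weights (n : ℕ) where

  -- The list 1, ..., n serves both as part sizes and as positive multiplicities. Thus T_j is
  -- `map (j *_) parts`, and the double sum over sizes and multiplicities is symmetric.
  parts : List ℕ
  parts = map suc (upTo n)

  partWeights : ℕ → List ℕ
  partWeights j = map (λ o → j * multiplicity o) (occurrences n)

  -- The exponents, with repetition, of the product over `js` of the factors 1 + 2 T_j. A sum
  -- `∑ (weights js) f` applies the linear functional sending q^w to `f w`.
  weights : List ℕ → List ℕ
  weights []       = [ 0 ]
  weights (j ∷ js) = cartesianProductWith _+_ (partWeights j) (weights js)

  -- The term `f 0` comes from `absent`; every positive multiplicity occurs twice, overlined and
  -- not, whence the factor 2.
  ∑-partWeights : ∀ j f → ∑ (partWeights j) f ≡ f 0 + 2 * ∑ (map (j *_) parts) f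
  ∑-partWeights j f = begin
    ∑ (partWeights j) f
      ≡⟨ ∑-map f (λ o → j * multiplicity o) (occurrences n) ⟩
    f (j * 0) + ∑ (concatMap (λ k → present false k ∷ present true k ∷ []) (upTo n))
                  (λ o → f (j * multiplicity o))
      ≡⟨ cong₂ _+_ (cong f (*-zeroʳ j)) (∑-concatMap _ _ (upTo n)) ⟩
    f 0 + ∑ (upTo n) (λ k → 2 * f (j * suc k))
      ≡⟨ cong (_+_ (f 0)) (∑-* 2 _ (upTo n)) ⟩
    f 0 + 2 * ∑ (upTo n) (λ k → f (j * suc k))
      ≡⟨ cong (λ x → f 0 + 2 * x) (trans (∑-map f (j *_) parts) (∑-map _ suc (upTo n))) ⟨
    f 0 + 2 * ∑ (map (j *_) parts) f ∎

  ∑-weights-∷ : ∀ j js f →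
    ∑ (weights (j ∷ js)) f ≡ ∑ (partWeights j) (λ y → ∑ (weights js) (λ z → f (y + z)))
  ∑-weights-∷ j js f = ∑-cartesianProductWith f _+_ (partWeights j) (weights js)

  ∑-weights-[-] : ∀ j f → ∑ (weights [ j ]) f ≡ f 0 + 2 * ∑ (map (j *_) parts) f
  ∑-weights-[-] j f = begin
    ∑ (weights [ j ]) f
      ≡⟨ ∑-weights-∷ j [] f ⟩
    ∑ (partWeights j) (λ y → f (y + 0) + 0)
      ≡⟨ ∑-cong (partWeights j) (λ y → trans (+-identityʳ _) (cong f (+-identityʳ y))) ⟩
    ∑ (partWeights j) f
      ≡⟨ ∑-partWeights j f ⟩
    f 0 + 2 * ∑ (map (j *_) parts) f ∎

  ∑-weights-++ : ∀ js ks f →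
    ∑ (weights (js ++ ks)) f ≡ ∑ (weights js) (λ y → ∑ (weights ks) (λ z → f (y + z)))
  ∑-weights-++ []       ks f = sym (+-identityʳ _)
  ∑-weights-++ (j ∷ js) ks f = begin
    ∑ (weights (j ∷ js ++ ks)) f
      ≡⟨ ∑-weights-∷ j (js ++ ks) f ⟩
    ∑ (partWeights j) (λ x → ∑ (weights (js ++ ks)) (λ w → f (x + w)))
      ≡⟨ ∑-cong (partWeights j) (λ x → ∑-weights-++ js ks (λ w → f (x + w))) ⟩
    ∑ (partWeights j) (λ x → ∑ (weights js) (λ y → ∑ (weights ks) (λ z → f (x + (y + z)))))
      ≡⟨ ∑-cong (partWeights j) (λ x → ∑-cong (weights js) (λ y → ∑-cong (weights ks) (λ z →
           cong f (+-assoc x y z)))) ⟨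
    ∑ (partWeights j) (λ x → ∑ (weights js) (λ y → ∑ (weights ks) (λ z → f (x + y + z))))
      ≡⟨ ∑-weights-∷ j js _ ⟨
    ∑ (weights (j ∷ js)) (λ y → ∑ (weights ks) (λ z → f (y + z))) ∎

  ∑-tables : ∀ {s} (cs : List (ColouredPart s)) f →
             ∑ (tables n cs) (f ∘ weight) ≡ ∑ (weights (map proj₁ cs)) f
  ∑-tables []             f = refl
  ∑-tables (c@(j , _) ∷ cs) f = begin
    ∑ (tables n (c ∷ cs)) (f ∘ weight)
      ≡⟨ ∑-cartesianProductWith (f ∘ weight) _∷_ (map (c ,_) (occurrences n)) (tables n cs) ⟩
    ∑ (map (c ,_) (occurrences n)) (λ x → ∑ (tables n cs) (λ t → f (weight (x ∷ t))))
      ≡⟨ ∑-map _ (c ,_) (occurrences n) ⟩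
    ∑ (occurrences n) (λ o → ∑ (tables n cs) (λ t → f (j * multiplicity o + weight t)))
      ≡⟨ ∑-cong (occurrences n) (λ o → ∑-tables cs (λ w → f (j * multiplicity o + w))) ⟩
    ∑ (occurrences n) (λ o → ∑ (weights (map proj₁ cs)) (λ w → f (j * multiplicity o + w)))
      ≡⟨ ∑-map _ (λ o → j * multiplicity o) (occurrences n) ⟨
    ∑ (partWeights j) (λ y → ∑ (weights (map proj₁ cs)) (λ w → f (y + w)))
      ≡⟨ ∑-weights-∷ j (map proj₁ cs) f ⟨
    ∑ (weights (map proj₁ (c ∷ cs))) f ∎

  -- Odd-degree parts of products and squares.

  -- For G = ∑_{w ∈ weights js} q^w and V = ∑_{v ∈ vs} q^v: G ≡ 1 mod 2, and the
  -- odd-degree parts satisfy G ≡ 2M V mod 4M.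
  record OddPart (M : ℕ) (js vs : List ℕ) : Set where
    field
      unit : ∀ f → ∃ λ c → ∑ (weights js) f ≡ f 0 + 2 * c
      odd  : ∀ f → OddSupported f →
             ∃ λ c → ∑ (weights js) f ≡ 2 * M * ∑ vs f + 4 * M * c

  open OddPart

  -- The odd-degree part of the first product times the whole second product, tested on `f`.
  crossTerm : List ℕ → List ℕ → (ℕ → ℕ) → ℕ
  crossTerm js ks f = ∑ (weights js) (λ y → parity y * ∑ (weights ks) (λ z → f (y + z)))

  ∑-weights-++-odd : ∀ js ks {f} → OddSupported f →
    ∑ (weights (js ++ ks)) f ≡ crossTerm js ks f + crossTerm ks js f
  ∑-weights-++-odd js ks {f} f-odd = begin
    ∑ (weights (js ++ ks)) f
      ≡⟨ ∑-weights-++ js ks f ⟩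
    ∑ J (λ y → ∑ K (λ z → f (y + z)))
      ≡⟨ ∑-cong J (λ y → trans (∑-cong K (odd-split f-odd y)) (∑-+ _ _ K)) ⟩
    ∑ J (λ y → ∑ K (λ z → parity y * f (y + z)) + ∑ K (λ z → parity z * f (y + z)))
      ≡⟨ ∑-+ _ _ J ⟩
    ∑ J (λ y → ∑ K (λ z → parity y * f (y + z))) + ∑ J (λ y → ∑ K (λ z → parity z * f (y + z)))
      ≡⟨ cong₂ _+_ (∑-cong J (λ y → ∑-* (parity y) _ K)) (∑-swap _ J K) ⟩
    crossTerm js ks f + ∑ K (λ z → ∑ J (λ y → parity z * f (y + z)))
      ≡⟨ cong (_+_ (crossTerm js ks f)) (∑-cong K (λ z → trans (∑-* (parity z) _ J)
           (cong (parity z *_) (∑-cong J (λ y → cong f (+-comm y z)))))) ⟩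
    crossTerm js ks f + crossTerm ks js f ∎
    where
    J = weights js
    K = weights ks

  -- The second factor is 1 mod 2, so multiplying by it changes the test function by an even amount
  -- on odd degrees. Paired with the odd-degree part 2M U of the first factor, this change is a
  -- multiple of 4M.
  crossTerm-mod : ∀ {M js ks us vs} → OddPart M js us → OddPart M ks vs → ∀ {f} →
    OddSupported f → ∃ λ c → crossTerm js ks f ≡ 2 * M * ∑ us f + 4 * M * c
  crossTerm-mod {M} {js} {ks} {us} {vs} J K {f} f-odd = ∑ us h + proj₁ (odd J g g-odd) , (begin
    crossTerm js ks f
      ≡⟨ proj₂ (odd J g g-odd) ⟩
    2 * M * ∑ us g + 4 * M * proj₁ (odd J g g-odd)
      ≡⟨ cong (λ x → 2 * M * x + 4 * M * proj₁ (odd J g g-odd)) ∑g ⟩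
    2 * M * (∑ us f + 2 * ∑ us h) + 4 * M * proj₁ (odd J g g-odd)
      ≡⟨ regroup M (∑ us f) (∑ us h) _ ⟩
    2 * M * ∑ us f + 4 * M * (∑ us h + proj₁ (odd J g g-odd)) ∎)
    where
    -- `g` absorbs the second factor into the test function; `2 * h` is its deviation from `f`.
    g h : ℕ → ℕ
    g y = parity y * ∑ (weights ks) (λ z → f (y + z))
    h y = parity y * proj₁ (unit K (λ z → f (y + z)))

    g-odd : OddSupported g
    g-odd y 2∣y = cong (_* ∑ (weights ks) (λ z → f (y + z))) (even⇒parity≡0 2∣y)

    distrib : ∀ a b c → a * (b + 2 * c) ≡ a * b + 2 * (a * c)
    distrib = solve-∀

    regroup : ∀ M a b c → 2 * M * (a + 2 * b) + 4 * M * c ≡ 2 * M * a + 4 * M * (b + c)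
    regroup = solve-∀

    g≗f+2h : ∀ y → g y ≡ f y + 2 * h y
    g≗f+2h y = begin
      g y
        ≡⟨ cong (parity y *_) (proj₂ (unit K (λ z → f (y + z)))) ⟩
      parity y * (f (y + 0) + 2 * proj₁ (unit K (λ z → f (y + z))))
        ≡⟨ distrib (parity y) (f (y + 0)) _ ⟩
      parity y * f (y + 0) + 2 * h y
        ≡⟨ cong (λ x → parity y * f x + 2 * h y) (+-identityʳ y) ⟩
      parity y * f y + 2 * h y
        ≡⟨ cong (_+ 2 * h y) (parity-*-odd {f} f-odd y) ⟩
      f y + 2 * h y ∎

    ∑g : ∑ us g ≡ ∑ us f + 2 * ∑ us h
    ∑g = trans (∑-cong us g≗f+2h) (trans (∑-+ f _ us) (cong (_+_ (∑ us f)) (∑-* 2 h us)))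

  unit-++ : ∀ {M js ks us vs} → OddPart M js us → OddPart M ks vs →
            ∀ f → ∃ λ c → ∑ (weights (js ++ ks)) f ≡ f 0 + 2 * c
  unit-++ {M} {js} {ks} J K f = proj₁ (unit K f) + proj₁ (unit J g) , (begin
    ∑ (weights (js ++ ks)) f
      ≡⟨ ∑-weights-++ js ks f ⟩
    ∑ (weights js) g
      ≡⟨ proj₂ (unit J g) ⟩
    g 0 + 2 * proj₁ (unit J g)
      ≡⟨ cong (_+ 2 * proj₁ (unit J g)) (proj₂ (unit K f)) ⟩
    f 0 + 2 * proj₁ (unit K f) + 2 * proj₁ (unit J g)
      ≡⟨ regroup (f 0) (proj₁ (unit K f)) _ ⟩
    f 0 + 2 * (proj₁ (unit K f) + proj₁ (unit J g)) ∎)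
    where
    g : ℕ → ℕ
    g y = ∑ (weights ks) (λ z → f (y + z))

    regroup : ∀ a b c → a + 2 * b + 2 * c ≡ a + 2 * (b + c)
    regroup = solve-∀

  OddPart-[] : ∀ {M} → OddPart M [] []
  OddPart-[] {M} .unit f       = 0 , refl
  OddPart-[] {M} .odd  f f-odd = 0 , trans (cong (_+ 0) (f-odd 0 (2 ∣0))) (vanish M)
    where
    vanish : ∀ M → 0 ≡ 2 * M * 0 + 4 * M * 0
    vanish = solve-∀

  OddPart-++ : ∀ {M js ks us vs} → OddPart M js us → OddPart M ks vs →
               OddPart M (js ++ ks) (us ++ vs)
  OddPart-++ J K .unit = unit-++ J K
  OddPart-++ {M} {js} {ks} {us} {vs} J K .odd f f-odd
    with crossTerm-mod J K f-odd | crossTerm-mod K J f-odd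
  ... | c , eq₁ | d , eq₂ = c + d , (begin
    ∑ (weights (js ++ ks)) f
      ≡⟨ ∑-weights-++-odd js ks f-odd ⟩
    crossTerm js ks f + crossTerm ks js f
      ≡⟨ cong₂ _+_ eq₁ eq₂ ⟩
    2 * M * ∑ us f + 4 * M * c + (2 * M * ∑ vs f + 4 * M * d)
      ≡⟨ regroup M (∑ us f) c (∑ vs f) d ⟩
    2 * M * (∑ us f + ∑ vs f) + 4 * M * (c + d)
      ≡⟨ cong (λ x → 2 * M * x + 4 * M * (c + d)) (∑-++ f us vs) ⟨
    2 * M * ∑ (us ++ vs) f + 4 * M * (c + d) ∎)
    where
    regroup : ∀ M a c b d →
      2 * M * a + 4 * M * c + (2 * M * b + 4 * M * d) ≡ 2 * M * (a + b) + 4 * M * (c + d)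
    regroup = solve-∀

  -- In odd degree the two cross terms of G² coincide, which gains the factor 2.
  OddPart-double : ∀ {M js vs} → OddPart M js vs → OddPart (2 * M) (js ++ js) vs
  OddPart-double J .unit = unit-++ J J
  OddPart-double {M} {js} {vs} J .odd f f-odd with crossTerm-mod J J f-odd
  ... | c , eq = c , (begin
    ∑ (weights (js ++ js)) f
      ≡⟨ ∑-weights-++-odd js js f-odd ⟩
    crossTerm js js f + crossTerm js js f
      ≡⟨ cong₂ _+_ eq eq ⟩
    2 * M * ∑ vs f + 4 * M * c + (2 * M * ∑ vs f + 4 * M * c)
      ≡⟨ regroup M (∑ vs f) c ⟩
    2 * (2 * M) * ∑ vs f + 4 * (2 * M) * c ∎)
    where
    regroup : ∀ M a c →
      2 * M * a + 4 * M * c + (2 * M * a + 4 * M * c) ≡ 2 * (2 * M) * a + 4 * (2 * M) * c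
    regroup = solve-∀

  -- The factors contributed by one part size, and their product.

  OddPart-[-] : ∀ j → OddPart 1 [ j ] (map (j *_) parts)
  OddPart-[-] j .unit f       = ∑ (map (j *_) parts) f , ∑-weights-[-] j f
  OddPart-[-] j .odd  f f-odd =
    0 , trans (∑-weights-[-] j f)
      (trans (cong (_+ 2 * ∑ (map (j *_) parts) f) (f-odd 0 (2 ∣0))) (sym (+-identityʳ _)))

  ∑-even-multiples : ∀ {j f} → 2 ∣ j → OddSupported f → ∑ (map (j *_) parts) f ≡ 0
  ∑-even-multiples {j} {f} 2∣j f-odd =
    trans (∑-map f (j *_) parts) (∑-zero parts (λ k → f-odd (j * k) (∣m⇒∣m*n k 2∣j)))

  -- All exponents are multiples of an even number, so both sides vanish in odd degree. The `a`
  -- copies are there to match the list obtained for odd `j`.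
  OddPart-even : ∀ {M j} a → 2 ∣ j → OddPart M [ j ] (concat (replicate a (map (j *_) parts)))
  OddPart-even {M} {j} a 2∣j .unit f       = ∑ (map (j *_) parts) f , ∑-weights-[-] j f
  OddPart-even {M} {j} a 2∣j .odd  f f-odd = 0 , (begin
    ∑ (weights [ j ]) f
      ≡⟨ ∑-weights-[-] j f ⟩
    f 0 + 2 * ∑ multiples f
      ≡⟨ cong₂ (λ x y → x + 2 * y) (f-odd 0 (2 ∣0)) (∑-even-multiples 2∣j f-odd) ⟩
    0
      ≡⟨ vanish M a ⟩
    2 * M * (a * 0) + 4 * M * 0
      ≡⟨ cong (λ x → 2 * M * (a * x) + 4 * M * 0) (∑-even-multiples 2∣j f-odd) ⟨
    2 * M * (a * ∑ multiples f) + 4 * M * 0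
      ≡⟨ cong (λ x → 2 * M * x + 4 * M * 0) (∑-concat-replicate f a multiples) ⟨
    2 * M * ∑ (concat (replicate a multiples)) f + 4 * M * 0 ∎)
    where
    multiples = map (j *_) parts

    vanish : ∀ M a → 0 ≡ 2 * M * (a * 0) + 4 * M * 0
    vanish = solve-∀

  -- Squaring m times: each squaring doubles M and keeps the list of multiples.
  OddPart-^ : ∀ m j → OddPart (2 ^ m) (replicate (2 ^ m) j) (map (j *_) parts)
  OddPart-^ zero    j = OddPart-[-] j
  OddPart-^ (suc m) j = subst (λ js → OddPart (2 ^ suc m) js (map (j *_) parts))
    (sym (trans (cong (λ t → replicate (2 ^ m + t) j) (+-identityʳ (2 ^ m)))
                (replicate-+ (2 ^ m) (2 ^ m))))
    (OddPart-double (OddPart-^ m j))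

  -- A product of `a` copies of the 2^m-th power: M stays fixed while the lists are concatenated.
  OddPart-*^ : ∀ m a j → OddPart (2 ^ m) (replicate (a * 2 ^ m) j)
                                         (concat (replicate a (map (j *_) parts)))
  OddPart-*^ m zero    j = OddPart-[]
  OddPart-*^ m (suc a) j = subst (λ js → OddPart (2 ^ m) js _)
    (sym (replicate-+ (2 ^ m) (a * 2 ^ m)))
    (OddPart-++ (OddPart-^ m j) (OddPart-*^ m a j))

  OddPart-colours : ∀ m a j → OddPart (2 ^ m) (replicate (colours (2 ^ m * a) j) j)
                                              (concat (replicate a (map (j *_) parts)))
  OddPart-colours m a j with 2 ∣? j
  ... | yes 2∣j = subst (λ t → OddPart (2 ^ m) (replicate t j) multiples)
    (sym (cong (if_then 1 else s) (dec-true (2 ∣? j) 2∣j)))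
    (OddPart-even a 2∣j)
    where
    s = 2 ^ m * a
    multiples = concat (replicate a (map (j *_) parts))
  ... | no  2∤j = subst (λ t → OddPart (2 ^ m) (replicate t j) multiples)
    (trans (*-comm a (2 ^ m)) (sym (cong (if_then 1 else s) (dec-false (2 ∣? j) 2∤j))))
    (OddPart-*^ m a j)
    where
    s = 2 ^ m * a
    multiples = concat (replicate a (map (j *_) parts))

  OddPart-concatMap : ∀ {M} {f g : ℕ → List ℕ} → (∀ j → OddPart M (f j) (g j)) →
                      ∀ js → OddPart M (concatMap f js) (concatMap g js)
  OddPart-concatMap h []       = OddPart-[]
  OddPart-concatMap h (j ∷ js) = OddPart-++ (h j) (OddPart-concatMap h js)

-- Colours matter only through how often each size is listed, which is all that `weights` sees.
sizes-colouredParts : ∀ s n →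
  map proj₁ (colouredParts s n) ≡ concatMap (λ j → replicate (colours s j) j) (map suc (upTo n))
sizes-colouredParts s n = trans (map-concatMap proj₁ _ js) (cong concat (map-cong sizes js))
  where
  js = map suc (upTo n)

  sizes-∷ : ∀ j (cs : List (Fin (colours s j))) →
            map proj₁ (map {B = ColouredPart s} (j ,_) cs) ≡ replicate (length cs) j
  sizes-∷ j []       = refl
  sizes-∷ j (c ∷ cs) = cong (j ∷_) (sizes-∷ j cs)

  sizes : ∀ j → map proj₁ (map (j ,_) (allFin (colours s j))) ≡ replicate (colours s j) j
  sizes j = trans (sizes-∷ j (allFin (colours s j)))
                  (cong (λ t → replicate t j) (length-tabulate {n = colours s j} id))

-- Counting positive square roots.

δ : ℕ → ℕ → ℕ
δ N w = if does (w ≟ N) then 1 else 0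

δ-refl : ∀ N → δ N N ≡ 1
δ-refl N = cong (if_then 1 else 0) (dec-true (N ≟ N) refl)

δ-≢ : ∀ {N w} → w ≢ N → δ N w ≡ 0
δ-≢ {N} {w} w≢N = cong (if_then 1 else 0) (dec-false (w ≟ N) w≢N)

-- The diagonal of the divisor count. It is 1 for a positive square and 0 for a nonsquare; a
-- positive root of N is at most N, so the range suffices.
#roots : ℕ → ℕ
#roots N = ∑ (map suc (upTo N)) (λ j → δ N (j * j))

#roots-nonSquare : ∀ {N} → (∀ j → j * j ≢ N) → #roots N ≡ 0
#roots-nonSquare {N} nonSquare = ∑-zero (map suc (upTo N)) (λ j → δ-≢ (nonSquare j))

square-injective : ∀ {i j} → i * i ≡ j * j → i ≡ j
square-injective {i} {j} eq with <-cmp i j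
... | tri< i<j _ _ = contradiction eq (<⇒≢ (*-mono-< i<j i<j))
... | tri≈ _ i≡j _ = i≡j
... | tri> _ _ j<i = contradiction (sym eq) (<⇒≢ (*-mono-< j<i j<i))

#roots-square : ∀ i → #roots (suc i * suc i) ≡ 1
#roots-square i = begin
  #roots N                                   ≡⟨ ∑-map _ suc (upTo N) ⟩
  -- The list entry `j` stands for the root `suc j`, so the bound `i < N` is
  -- `suc i ≤ suc i * suc i`.
  ∑ (upTo N) (λ j → δ N (suc j * suc j))     ≡⟨ ∑-upTo-single _ (m≤m*n (suc i) (suc i)) unique ⟩
  δ N N                                      ≡⟨ δ-refl N ⟩
  1                                          ∎
  where
  N = suc i * suc i

  unique : ∀ j → j ≢ i → δ N (suc j * suc j) ≡ 0
  unique j j≢i = δ-≢ (λ eq → j≢i (suc-injective (square-injective eq)))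

-- The divisors of N pair off as {j, N / j} apart from the square root of N.
ā-odd : ∀ m a {N} → 2 ∤ N →
        ∃ λ c → ā (2 ^ m * a) N ≡ 2 * 2 ^ m * (a * #roots N) + 4 * 2 ^ m * c
ā-odd m a {N} 2∤N = a * c + d , (begin
  ā s N
    ≡⟨ ∑-filter (λ t → weight t ≟ N) (tables N (colouredParts s N)) ⟩
  ∑ (tables N (colouredParts s N)) (δ N ∘ weight)
    ≡⟨ ∑-tables (colouredParts s N) (δ N) ⟩
  ∑ (weights (map proj₁ (colouredParts s N))) (δ N)
    ≡⟨ cong (λ js → ∑ (weights js) (δ N)) (sizes-colouredParts s N) ⟩
  ∑ (weights (concatMap (λ j → replicate (colours s j) j) parts)) (δ N)
    ≡⟨ proj₂ oddPart ⟩
  2 * 2 ^ m * ∑ (concatMap (λ j → concat (replicate a (map (j *_) parts))) parts) (δ N)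
    + 4 * 2 ^ m * d
    ≡⟨ cong (λ x → 2 * 2 ^ m * x + 4 * 2 ^ m * d) divisorPairs ⟩
  2 * 2 ^ m * (a * (#roots N + 2 * c)) + 4 * 2 ^ m * d
    ≡⟨ regroup (2 ^ m) a (#roots N) c d ⟩
  2 * 2 ^ m * (a * #roots N) + 4 * 2 ^ m * (a * c + d) ∎)
  where
  open Weights N

  s = 2 ^ m * a

  -- Since N is odd, `δ N` is an admissible test function; it reads off the coefficient of q^N.
  δ-odd : OddSupported (δ N)
  δ-odd w 2∣w = δ-≢ (λ w≡N → 2∤N (subst (2 ∣_) w≡N 2∣w))

  oddPart = OddPart.odd (OddPart-concatMap (OddPart-colours m a) parts) (δ N) δ-odd
  d = proj₁ oddPart

  symmetric = ∑-symmetric (λ j k → δ N (j * k)) (λ j k → cong (δ N) (*-comm j k)) parts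
  c = proj₁ symmetric

  divisorPairs : ∑ (concatMap (λ j → concat (replicate a (map (j *_) parts))) parts) (δ N)
                   ≡ a * (#roots N + 2 * c)
  divisorPairs = begin
    ∑ (concatMap (λ j → concat (replicate a (map (j *_) parts))) parts) (δ N)
      ≡⟨ ∑-concatMap (δ N) _ parts ⟩
    ∑ parts (λ j → ∑ (concat (replicate a (map (j *_) parts))) (δ N))
      ≡⟨ ∑-cong parts (λ j → trans (∑-concat-replicate (δ N) a (map (j *_) parts))
                                   (cong (a *_) (∑-map (δ N) (j *_) parts))) ⟩
    ∑ parts (λ j → a * ∑ parts (λ k → δ N (j * k)))
      ≡⟨ ∑-* a _ parts ⟩
    a * ∑ parts (λ j → ∑ parts (λ k → δ N (j * k)))
      ≡⟨ cong (a *_) (proj₂ symmetric) ⟩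
    a * (#roots N + 2 * c) ∎

  regroup : ∀ M a r c d →
    2 * M * (a * (r + 2 * c)) + 4 * M * d ≡ 2 * M * (a * r) + 4 * M * (a * c + d)
  regroup = solve-∀

-- Squares divisible by a prime.

square? : ∀ N → (∃ λ i → i * i ≡ N) ⊎ (∀ i → i * i ≢ N)
square? N with anyUpTo? (λ i → i * i ≟ N) (suc N)
... | yes (i , _ , i²≡N) = inj₁ (i , i²≡N)
... | no  ¬root          = inj₂ (λ i i²≡N → ¬root (i , s≤s (i≤N i i²≡N) , i²≡N))
  where
  i≤N : ∀ i → i * i ≡ N → i ≤ N
  i≤N zero    _    = z≤n
  i≤N (suc i) i²≡N = subst (suc i ≤_) i²≡N (m≤m*n (suc i) (suc i))

module _ {p} (p-prime : Prime p) where

  private instance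
    p≢0 : NonZero p
    p≢0 = prime⇒nonZero p-prime

  -- Euclid's lemma gives j = i p; cancelling one p leaves b = i² p. This form contradicts `p ∤ b`,
  -- and for b = M p it yields M = i².
  square⇒p*square : ∀ {b} j → j * j ≡ p * b → ∃ λ i → i * i * p ≡ b
  square⇒p*square {b} j j²≡pb
    with [ id , id ]′ (euclidsLemma j j p-prime (subst (p ∣_) (sym j²≡pb) (m∣m*n b)))
  ... | divides i refl = i , *-cancelˡ-≡ (i * i * p) b p (trans (regroup i p) j²≡pb)
    where
    regroup : ∀ i p → p * (i * i * p) ≡ i * p * (i * p)
    regroup = solve-∀

  #roots-p* : ∀ {b} → p ∤ b → #roots (p * b) ≡ 0
  #roots-p* p∤b = #roots-nonSquare λ j j²≡pb →
    let i , i²p≡b = square⇒p*square j j²≡pb in p∤b (divides (i * i) (sym i²p≡b))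

  -- The map i ↦ p i matches roots of M with roots of p² M. The shape `p * (M * p)` is that of
  -- `p * b` once a divisibility witness b = M p is substituted.
  #roots-p²* : ∀ {M} → M ≢ 0 → #roots (p * (M * p)) ≡ #roots M
  #roots-p²* {M} M≢0 with square? M
  ... | inj₁ (zero  , i²≡M) = contradiction (sym i²≡M) M≢0
  ... | inj₁ (suc i , refl) = begin
    #roots (p * (suc i * suc i * p))    ≡⟨ cong #roots (regroup p (suc i)) ⟩
    -- The root p (i + 1) is rewritten as a successor, the form `#roots-square` expects.
    #roots (p * suc i * (p * suc i))    ≡⟨ cong (λ x → #roots (x * x)) (suc-pred (p * suc i)) ⟨
    #roots (suc l * suc l)              ≡⟨ #roots-square l ⟩
    1                                   ≡⟨ #roots-square i ⟨
    #roots (suc i * suc i)              ∎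
    where
    instance
      p*i≢0 : NonZero (p * suc i)
      p*i≢0 = m*n≢0 p (suc i)

    l = pred (p * suc i)

    regroup : ∀ p i → p * (i * i * p) ≡ p * i * (p * i)
    regroup = solve-∀
  ... | inj₂ nonSquare = trans
    (#roots-nonSquare λ j j²≡ →
      let i , i²p≡Mp = square⇒p*square j j²≡ in nonSquare i (*-cancelʳ-≡ (i * i) M p i²p≡Mp))
    (sym (#roots-nonSquare nonSquare))

-- Evaluating the count at a rational argument.

/-+-/ : ∀ a b p → toℚᵘ ((+ a) / suc p +ℚ (+ b) / suc p) ≃ mkℚᵘ (+ (a + b)) p
/-+-/ a b p = ℚᵘ.≃-trans (ℚ.toℚᵘ-homo-+ ((+ a) / suc p) ((+ b) / suc p))
  (ℚᵘ.≃-trans (ℚᵘ.+-cong (ℚ.toℚᵘ-fromℚᵘ (mkℚᵘ (+ a) p)) (ℚ.toℚᵘ-fromℚᵘ (mkℚᵘ (+ b) p)))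
              (*≡* (commonDenominator (+ a) (+ b) (+ suc p))))
  where
  commonDenominator : ∀ a b p → (a ℤ.* p ℤ.+ b ℤ.* p) ℤ.* p ≡ (a ℤ.+ b) ℤ.* (p ℤ.* p)
  commonDenominator = ℤ.solve-∀

-- Comparing `x` with an unnormalised fraction avoids computing gcds, and injectivity of `toℚᵘ`
-- recovers the reduced form. In `mkℚᵘ (+ b) p` the denominator is `suc p`.
āℚ-integral : ∀ s {x b p} M → toℚᵘ x ≃ mkℚᵘ (+ b) p → b ≡ M * suc p → āℚ s x ≡ ā s M
āℚ-integral s {x} {b} {p} M x≃b/p refl =
  cong (āℚ s) (ℚ.toℚᵘ-injective {x} {mkℚ (+ M) 0 (coprime-sym (1-coprimeTo M))}
    (ℚᵘ.≃-trans x≃b/p (*≡* (trans (ℤ.*-identityʳ _) (ℤ.pos-* M (suc p))))))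

-- An integral `x = z` would give b = z (p + 1), against the hypothesis; at every other rational
-- `āℚ` is 0 by its default clause.
āℚ-fractional : ∀ s {x b p} → toℚᵘ x ≃ mkℚᵘ (+ b) p → suc p ∤ b → āℚ s x ≡ 0
āℚ-fractional s {mkℚ (+ z) zero _} {b} {p} (*≡* eq) p∤b =
  contradiction (divides z (sym (ℤ.+-injective
    (trans (ℤ.pos-* z (suc p)) (trans eq (ℤ.*-identityʳ (+ b))))))) p∤b
āℚ-fractional s {mkℚ (+ _) (suc _) _}    _ _ = refl
āℚ-fractional s {mkℚ ℤ.-[1+ _ ] _ _}     _ _ = refl

-- Comparing residues at p b and b / p.

common-residue : ∀ {x y M} w c d → x ≡ w + M * c → y ≡ w + M * d → x ≡ y [mod M ]
common-residue {M = M} w c d refl refl = ℤ.∣⇒∣ᵤ {+ M} (ℤ.divides (+ c ℤ.- + d) (begin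
  + (w + M * c) ℤ.- + (w + M * d)
    ≡⟨ cong₂ (λ u v → (+ w ℤ.+ u) ℤ.- (+ w ℤ.+ v)) (ℤ.pos-* M c) (ℤ.pos-* M d) ⟩
  (+ w ℤ.+ + M ℤ.* + c) ℤ.- (+ w ℤ.+ + M ℤ.* + d)
    ≡⟨ regroup (+ w) (+ M) (+ c) (+ d) ⟩
  (+ c ℤ.- + d) ℤ.* + M ∎))
  where
  regroup : ∀ w M c d → (w ℤ.+ M ℤ.* c) ℤ.- (w ℤ.+ M ℤ.* d) ≡ (c ℤ.- d) ℤ.* M
  regroup = ℤ.solve-∀

2∤1+2* : ∀ n → 2 ∤ 1 + 2 * n
2∤1+2* n 2∣ = contradiction (∣m+n∣m⇒∣n (subst (2 ∣_) (+-comm 1 (2 * n)) 2∣) (m∣m*n n)) λ where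
  (divides (suc (suc _)) ())

-- Both sides are reduced by `ā-odd`. If the prime does not divide b, then p b is not a square and
-- the right side is 0. Otherwise b = M p, the root counts of p² M and M agree, and the factor p²
-- does not affect the residue.
ā-p² : ∀ m a {p b e} (x : ℚ) → Prime (suc p) → suc p ≡ 1 + 2 * e → 2 ∤ suc p * b →
       toℚᵘ x ≃ mkℚᵘ (+ b) p →
       ā (2 ^ m * a) (suc p * b) ≡ suc p ^ 2 * āℚ (2 ^ m * a) x [mod 4 * 2 ^ m ]
ā-p² m a {p} {b} {e} x p-prime p≡1+2e pb-odd x≃b/p with suc p ∣? b | ā-odd m a pb-odd
... | no p∤b | c , ā[pb] = common-residue 0 c 0
  (begin
    ā s (suc p * b)
      ≡⟨ ā[pb] ⟩
    2 * 2 ^ m * (a * #roots (suc p * b)) + 4 * 2 ^ m * c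
      ≡⟨ cong (λ r → 2 * 2 ^ m * (a * r) + 4 * 2 ^ m * c) (#roots-p* p-prime p∤b) ⟩
    2 * 2 ^ m * (a * 0) + 4 * 2 ^ m * c
      ≡⟨ cong (_+ 4 * 2 ^ m * c) (trans (cong (2 * 2 ^ m *_) (*-zeroʳ a)) (*-zeroʳ (2 * 2 ^ m))) ⟩
    4 * 2 ^ m * c ∎)
  (begin
    suc p ^ 2 * āℚ s x   ≡⟨ cong (suc p ^ 2 *_) (āℚ-fractional s x≃b/p p∤b) ⟩
    suc p ^ 2 * 0        ≡⟨ *-zeroʳ (suc p ^ 2) ⟩
    0                    ≡⟨ *-zeroʳ (4 * 2 ^ m) ⟨
    4 * 2 ^ m * 0        ∎)
  where s = 2 ^ m * a
... | yes (divides M refl) | c , ā[pb] = common-residue (2 * 2 ^ m * t) c _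
  (trans ā[pb] (cong (λ r → 2 * 2 ^ m * (a * r) + 4 * 2 ^ m * c) (#roots-p²* p-prime M≢0)))
  (begin
    suc p ^ 2 * āℚ s x
      ≡⟨ cong₂ (λ q y → q ^ 2 * y) p≡1+2e (trans (āℚ-integral s M x≃b/p refl) (proj₂ ā[M])) ⟩
    (1 + 2 * e) ^ 2 * (2 * 2 ^ m * t + 4 * 2 ^ m * d)
      -- Here (1 + 2e)² = 1 + 4(e + e²), so the square adds only a multiple of 4 · 2^m.
      ≡⟨ regroup e (2 ^ m) t d ⟩
    2 * 2 ^ m * t + 4 * 2 ^ m * (d + (e + e * e) * (2 * t + 4 * d)) ∎)
  where
  s = 2 ^ m * a
  t = a * #roots M

  M-odd : 2 ∤ M
  M-odd 2∣M = pb-odd (∣n⇒∣m*n (suc p) (∣m⇒∣m*n (suc p) 2∣M))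

  M≢0 : M ≢ 0
  M≢0 refl = M-odd (2 ∣0)

  ā[M] = ā-odd m a M-odd
  d = proj₁ ā[M]

  regroup : ∀ e M t d → (1 + 2 * e) * ((1 + 2 * e) * 1) * (2 * M * t + 4 * M * d)
                        ≡ 2 * M * t + 4 * M * (d + (e + e * e) * (2 * t + 4 * d))
  regroup = solve-∀

theorem1p4 : ∀ (k n m α β p r : ℕ) → .{{_ : NonZero p}} →
    1 ≤ m → 1 ≤ α → 1 ≤ β → 2 ∤ α →
    3 ≤ p → Prime p → p % 4 ≡ 3 →
    p ∣ 4 * r + 3 →
    ā (2 ^ m * α) (4 * p ^ (k + 1) * n + 4 * p * r + 3 * p)
    ≡ p ^ 2 * āℚ (2 ^ m * α) ((+ (4 * p ^ k * n)) / p +ℚ (+ (4 * r + 3)) / p)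
    [mod 2 ^ (m + 2) ]
    ×
    ā (2 * β + 1) (4 * p ^ (k + 1) * n + 4 * p * r + 3 * p)
    ≡ p ^ 2 * āℚ (2 * β + 1) ((+ (4 * p ^ k * n)) / p +ℚ (+ (4 * r + 3)) / p)
    [mod 4 ]
theorem1p4 k n m α β (suc p′) r _ _ _ _ _ p-prime p%4≡3 _ =
    subst₂ (λ N M → ā s N ≡ p ^ 2 * āℚ s x [mod M ]) (sym N≡pb) 4*2^m (congruence m α)
  -- An odd number of colours is the case m = 0, where s is `1 * (2 * β + 1)` and the modulus 4 ·
  -- 2^0 evaluates to 4.
  , subst₂ (λ s N → ā s N ≡ p ^ 2 * āℚ s x [mod 4 ]) (*-identityˡ (2 * β + 1)) (sym N≡pb)
           (congruence 0 (2 * β + 1))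
  where
  p = suc p′
  s = 2 ^ m * α
  -- The left argument is p b and the right one is b / p; dividing p^k by p replaces the exponent k
  -- - 1, which is negative for k = 0.
  b = 4 * p ^ k * n + (4 * r + 3)
  x = (+ (4 * p ^ k * n)) / p +ℚ (+ (4 * r + 3)) / p
  q = p ℕ./ 4

  N≡pb : 4 * p ^ (k + 1) * n + 4 * p * r + 3 * p ≡ p * b
  N≡pb = trans (cong (λ P → 4 * P * n + 4 * p * r + 3 * p) (cong (p ^_) (+-comm k 1)))
               (factor p (p ^ k) n r)
    where
    factor : ∀ p P n r → 4 * (p * P) * n + 4 * p * r + 3 * p ≡ p * (4 * P * n + (4 * r + 3))
    factor = solve-∀

  4*2^m : 4 * 2 ^ m ≡ 2 ^ (m + 2)
  4*2^m = trans (*-comm 4 (2 ^ m)) (sym (^-distribˡ-+-* 2 m 2))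

  p≡1+2e : p ≡ 1 + 2 * (1 + 2 * q)
  p≡1+2e = trans (m≡m%n+[m/n]*n p 4) (trans (cong (λ i → i + q * 4) p%4≡3) (regroup q))
    where
    regroup : ∀ q → 3 + q * 4 ≡ 1 + 2 * (1 + 2 * q)
    regroup = solve-∀

  pb-odd : 2 ∤ p * b
  -- The witness expands a product of odd numbers: b = 1 + 2(1 + 2 p^k n + 2r), and p = 1 + 2(1 +
  -- 2q) adds 2(1 + 2q) b.
  pb-odd = subst (2 ∤_) (sym (trans (cong (_* b) p≡1+2e) (regroup q (p ^ k) n r)))
                 (2∤1+2* (1 + 2 * p ^ k * n + 2 * r + (1 + 2 * q) * b))
    where
    regroup : ∀ q P n r → (1 + 2 * (1 + 2 * q)) * (4 * P * n + (4 * r + 3))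
      ≡ 1 + 2 * (1 + 2 * P * n + 2 * r + (1 + 2 * q) * (4 * P * n + (4 * r + 3)))
    regroup = solve-∀

  congruence : ∀ m a →
    ā (2 ^ m * a) (p * b) ≡ p ^ 2 * āℚ (2 ^ m * a) x [mod 4 * 2 ^ m ]
  congruence m a = ā-p² m a {e = 1 + 2 * q} x p-prime p≡1+2e pb-odd
    (/-+-/ (4 * p ^ k * n) (4 * r + 3) p′)
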